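{- There is an absolute constant $C>0$ such that for all positive integers $n,r$ and every input $\mathcal I$ of online Min-Sum Set Cover over a universe of $n$ elements whose requested sets have cardinality at most $r$, $$\mathrm{DLM}(\mathcal I)\le C\, r^2\cdot \mathrm{OPT}(\mathcal I).$$ Here $\mathrm{OPT}(\mathcal I)$ is the minimum total cost of any offline algorithm that starts from the same initial permutation $\pi_0$ and may reorder its list arbitrarily. In other words, DLM is strictly $O(r^2)$-competitive in the dynamic scenario.
   Context: Online Min-Sum Set Cover (MSSC). Let $\mathcal U$ be a universe of $n$ elements. A permutation is a bijection $\pi:\mathcal U\to\{1,\dots,n\}$, where $\pi(z)$ is the list position of $z$. An input $\mathcal I$ consists of an initial permutation $\pi_0$ and a sequence of nonempty sets $R_1,\dots,R_m\subseteq\mathcal U$, each of cardinality at most $r$. In step $t$, an algorithm holding permutation $\pi_{t-1}$ is shown $R_t$ and pays the access cost $\min_{z\in R_t}\pi_{t-1}(z)$. It then picks a new permutation $\pi_t$ and pays the reordering cost $d(\pi_{t-1},\pi_t)$, which is the minimum number of swaps of adjacent elements turning $\pi_{t-1}$ into $\pi_t$. An online algorithm chooses $\pi_t$ without knowing future requests or $m$. $A(\mathcal I)$ denotes the total cost of algorithm $A$ on $\mathcal I$. Algorithm DLM. Every element $z$ has a budget $b(z)$, initially $0$. The operation fetch$(z)$ moves $z$ to position 1 by $\pi(z)-1$ adjacent swaps, so every element that preceded $z$ moves back by one position, and then sets $b(z)\gets 0$. On a request $R$ with $|R|=s$, let $x\in R$ be the element of $R$ with the smallest current position and let $\ell=\pi(x)$.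 DLM pays access cost $\ell$ and executes fetch$(x)$. For every $y\in R\setminus\{x\}$ it sets $b(y)\gets b(y)+\ell/s$. Finally, while some element $z$ has $b(z)\ge \pi(z)$, it executes fetch$(z)$ for such a $z$. -}

module Defs where

open import Data.Nat as ℕ using (ℕ; zero; suc; _+_; _≤_; _<_)
open import Data.Integer using (+_)
open import Data.Rational as ℚ using (ℚ; 0ℚ; _/_)
open import Data.Fin using (Fin; toℕ; _≟_)
open import Data.Fin.Subset using (Subset; _∈_; ∣_∣)
open import Data.Fin.Permutation using (Permutation′; _⟨$⟩ʳ_; transpose)
open import Data.Vec using (lookup)
open import Data.Bool using (if_then_else_)
open import Data.Product using (Σ; ∃; _×_)
open import Data.List using (List; []; _∷_)
open import Relation.Nullary using (¬_; does)
open import Relation.Binary.PropositionalEquality using (_≡_)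

-- The universe is Fin n.  A permutation π : Permutation′ n maps each element
-- to its (0-based) index; the list position (1-based, as in the paper) is:
pos : ∀ {n} → Permutation′ n → Fin n → ℕ
pos π z = suc (toℕ (π ⟨$⟩ʳ z))

AdjSwap : ∀ {n} → Permutation′ n → Permutation′ n → Set
AdjSwap {n} π σ = Σ (Fin n) λ p → Σ (Fin n) λ q → (toℕ q ≡ suc (toℕ p)) ×
  (∀ z → σ ⟨$⟩ʳ z ≡ transpose p q ⟨$⟩ʳ (π ⟨$⟩ʳ z))

data Swaps {n} : Permutation′ n → Permutation′ n → ℕ → Set where
  none : ∀ {π σ} → (∀ z → π ⟨$⟩ʳ z ≡ σ ⟨$⟩ʳ z) → Swaps π σ 0
  more : ∀ {π τ σ k} → AdjSwap π τ → Swaps τ σ k → Swaps π σ (suc k)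

IsDist : ∀ {n} → Permutation′ n → Permutation′ n → ℕ → Set
IsDist π σ k = Swaps π σ k × (∀ j → Swaps π σ j → k ≤ j)

MinIn : ∀ {n} → Permutation′ n → Subset n → Fin n → Set
MinIn π R x = x ∈ R × (∀ y → y ∈ R → pos π x ≤ pos π y)

AccessCost : ∀ {n} → Permutation′ n → Subset n → ℕ → Set
AccessCost π R ℓ = ∃ λ x → MinIn π R x × pos π x ≡ ℓ

Fetch : ∀ {n} → Permutation′ n → Fin n → Permutation′ n → Set
Fetch π z π' = (pos π' z ≡ 1)
  × (∀ y → ¬ y ≡ z → pos π y < pos π z → pos π' y ≡ suc (pos π y))
  × (∀ y → ¬ y ≡ z → pos π z < pos π y → pos π' y ≡ pos π y)

Budget : ℕ → Set
Budget n = Fin n → ℚ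

reset : ∀ {n} → Budget n → Fin n → Budget n
reset b z y = if does (y ≟ z) then 0ℚ else b y

posℚ : ∀ {n} → Permutation′ n → Fin n → ℚ
posℚ π z = (+ pos π z) / 1

-- The while-loop of DLM: repeatedly fetch some z with b(z) ≥ π(z) (any such z,
-- chosen arbitrarily) until no such element remains.
data Cleanup {n} : Permutation′ n → Budget n → Permutation′ n → Budget n → Set where
  stop : ∀ {π b} → (∀ z → b z ℚ.< posℚ π z) → Cleanup π b π b
  fetch : ∀ {π b π₁ π' b'} (z : Fin n) → posℚ π z ℚ.≤ b z → Fetch π z π₁ →
          Cleanup π₁ (reset b z) π' b' → Cleanup π b π' b'

data DLMStep {n} (R : Subset n) (π : Permutation′ n) (b : Budget n)
     : Permutation′ n → Budget n → ℕ → Set where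
  step : ∀ {π₁ π' b'} (x : Fin n) (k : ℕ) → ∣ R ∣ ≡ suc k → MinIn π R x →
         Fetch π x π₁ →
         Cleanup π₁
           (λ y → if does (y ≟ x) then 0ℚ
                  else (if lookup R y then b y ℚ.+ (+ pos π x) / suc k else b y))
           π' b' →
         DLMStep R π b π' b' (pos π x)

data DLMRun {n} : Permutation′ n → Budget n → List (Subset n) → ℕ → Set where
  done : ∀ {π b} → DLMRun π b [] 0
  next : ∀ {R Rs π b π' b' ℓ k c} → DLMStep R π b π' b' ℓ → IsDist π π' k →
         DLMRun π' b' Rs c → DLMRun π b (R ∷ Rs) (ℓ + k + c)

data OffRun {n} : Permutation′ n → List (Subset n) → ℕ → Set where
  done : ∀ {π} → OffRun π [] 0
  next : ∀ {R Rs π π' ℓ k c} → AccessCost π R ℓ → IsDist π π' k →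
         OffRun π' Rs c → OffRun π (R ∷ Rs) (ℓ + k + c)

{-# OPTIONS --safe #-}
-- Amortised analysis.  With p, q the positions of an element in the lists of
-- DLM and of the offline algorithm, b its budget and γ = 5r, let the element
-- carry the potential 2b + max(0, 4γ(p − 4γq) − γb).
--   A fetch from position P increases only terms of elements with 4γq ≤ P; there
-- are at most P / 4γ of them and each grows by at most 4γ, so the fetch raises
-- the other terms by at most P in total, and in the cleanup loop the term 2b ≥ 2P
-- of the fetched element pays for this and for the swaps.  Serving a request
-- first met at position ℓ thus raises the potential by at most ℓ + 2ℓ.  If the
-- offline access cost q is at least ℓ / 8γ, it pays for everything, since
-- 5ℓ ≤ 200 r q.  Otherwise the element the offline algorithm accesses is in the
-- linear regime, since b < p between requests, and its term drops by at least 5ℓ: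
-- either it is itself fetched or its budget grows by ℓ / s ≥ ℓ / r, s = |R|.
-- Finally, an offline swap moves one element forward by one position, which
-- costs (4γ)² = 400 r².
module Submission where

open import Defs
open import Data.Bool using (true; false; if_then_else_)
open import Data.Fin using (Fin; zero; suc; toℕ; fromℕ<; _≟_)
import Data.Fin.Properties as Fin
open import Data.Fin.Permutation
  using (Permutation′; _⟨$⟩ʳ_; _⟨$⟩ˡ_; transpose; _∘ₚ_; inverseʳ)
open import Data.Fin.Subset using (Subset; Nonempty; ∣_∣; _∈_)
open import Data.Integer as ℤ using (+_)
import Data.Integer.Properties as ℤ
open import Data.List using (List; []; _∷_)
open import Data.List.Relation.Unary.All using (All; []; _∷_)
open import Data.Nat as ℕ using (ℕ; zero; suc; _+_; _∸_; _≤_; _<_; _*_; _^_; z≤n; s≤s)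
import Data.Nat.Properties as ℕ
open import Data.Nat.Tactic.RingSolver using (solve-∀)
open import Data.Product using (Σ; ∃; _×_; _,_; proj₁; proj₂)
open import Data.Rational as ℚ using (ℚ; 0ℚ; 1ℚ; _/_; toℚᵘ; fromℚᵘ)
import Data.Rational.Properties as ℚ
open import Data.Rational.Solver using (module +-*-Solver)
open import Data.Rational.Unnormalised as ℚᵘ using (mkℚᵘ; *≡*; *≤*)
import Data.Rational.Unnormalised.Properties as ℚᵘ
open import Data.Sum using (_⊎_; inj₁; inj₂)
open import Data.Vec using ([]; _∷_; lookup)
open import Data.Vec.Properties using ([]=⇒lookup)
open import Function using (_∘_)
open import Function.Bundles using (Injection)
open import Function.Properties.Inverse using (↔⇒↣)
open import Relation.Binary.Definitions using (tri<; tri≈; tri>)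
open import Relation.Binary.PropositionalEquality
open import Relation.Nullary using (¬_; Dec; yes; no; does; contradiction)
open import Relation.Nullary.Decidable using (dec-true; dec-false)
open import Algebra.Properties.CommutativeMonoid.Sum ℚ.+-0-commutativeMonoid
  using (sum; sum-permute; ∑-distrib-+)
open +-*-Solver using (solve; con; _:=_; _:+_; _:*_; :-_; _:-_)

-- List positions under fetches and adjacent swaps.

transpose-cases : ∀ {n} (p q i : Fin n) →
  (i ≡ p × transpose p q ⟨$⟩ʳ i ≡ q) ⊎
  (i ≡ q × transpose p q ⟨$⟩ʳ i ≡ p) ⊎
  (i ≢ p × i ≢ q × transpose p q ⟨$⟩ʳ i ≡ i)
transpose-cases p q i with i ≟ p
... | yes i≡p = inj₁ (i≡p , refl)
... | no i≢p with i ≟ q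
...   | yes i≡q = inj₂ (inj₁ (i≡q , refl))
...   | no i≢q = inj₂ (inj₂ (i≢p , i≢q , refl))

pos-injective : ∀ {n} (π : Permutation′ n) {y z} → pos π y ≡ pos π z → y ≡ z
pos-injective π e = Injection.injective (↔⇒↣ π) (Fin.toℕ-injective (ℕ.suc-injective e))

-- `none` records only pointwise equality, so composing with a further chain of swaps means
-- transporting that chain along it.
Swaps-respˡ : ∀ {n} (π σ {τ} : Permutation′ n) {k} →
  (∀ z → π ⟨$⟩ʳ z ≡ σ ⟨$⟩ʳ z) → Swaps σ τ k → Swaps π τ k
Swaps-respˡ _ _ π≈σ (none σ≈τ) = none λ z → trans (π≈σ z) (σ≈τ z)
Swaps-respˡ π σ π≈σ (more (p , q , q≡1+p , σ→ρ) s) =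
  more (p , q , q≡1+p , λ z → trans (σ→ρ z) (cong (transpose p q ⟨$⟩ʳ_) (sym (π≈σ z)))) s

Swaps-trans : ∀ {n} {π σ τ : Permutation′ n} {j k} →
  Swaps π σ j → Swaps σ τ k → Swaps π τ (j + k)
Swaps-trans (none {π} {σ} π≈σ) t = Swaps-respˡ π σ π≈σ t
Swaps-trans (more a s) t = more a (Swaps-trans s t)

Fetch-cases : ∀ {n} (π : Permutation′ n) {π₁ z} → Fetch π z π₁ → ∀ y → y ≢ z →
  (pos π y < pos π z × pos π₁ y ≡ suc (pos π y)) ⊎ (pos π z < pos π y × pos π₁ y ≡ pos π y)
Fetch-cases π {z = z} (_ , before , after) y y≢z with ℕ.<-cmp (pos π y) (pos π z)
... | tri< y<z _ _ = inj₁ (y<z , before y y≢z y<z)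
... | tri≈ _ y≡z _ = contradiction (pos-injective π y≡z) y≢z
... | tri> _ _ z<y = inj₂ (z<y , after y y≢z z<y)

-- Induction on the distance to the front: after `z` is swapped with its predecessor, `π₁` is still
-- the result of fetching `z`, now from `τ`.
Fetch⇒Swaps : ∀ {n} k {π π₁ : Permutation′ n} {z} →
  pos π z ≡ suc k → Fetch π z π₁ → Swaps π π₁ k
Fetch⇒Swaps zero {π} {π₁} {z} πz≡1 F@(π₁z≡1 , _) = none {π = π} {π₁} λ y →
  Fin.toℕ-injective (ℕ.suc-injective (same y))
  where
  same : ∀ y → pos π y ≡ pos π₁ y
  same y with y ≟ z
  ... | yes refl = trans πz≡1 (sym π₁z≡1)
  ... | no y≢z with Fetch-cases π {π₁} F y y≢z
  ...   | inj₁ (y<z , _) = contradiction (subst (pos π y <_) πz≡1 y<z) λ { (s≤s ()) }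
  ...   | inj₂ (_ , e) = sym e
Fetch⇒Swaps {n} (suc k) {π} {π₁} {z} πz≡2+k F@(π₁z≡1 , _) =
  more (p , q , q≡1+p , λ _ → refl) (Fetch⇒Swaps k {τ} τz≡1+k (π₁z≡1 , before , after))
  where
  q = π ⟨$⟩ʳ z
  toℕq : toℕ q ≡ suc k
  toℕq = ℕ.suc-injective πz≡2+k
  k<n : k < n
  k<n = ℕ.<-trans (ℕ.≤-reflexive (sym toℕq)) (Fin.toℕ<n q)
  p = fromℕ< k<n
  toℕp : toℕ p ≡ k
  toℕp = Fin.toℕ-fromℕ< k<n
  q≡1+p : toℕ q ≡ suc (toℕ p)
  q≡1+p = trans toℕq (cong suc (sym toℕp))
  τ = π ∘ₚ transpose p q
  τz≡1+k : pos τ z ≡ suc k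
  τz≡1+k with transpose-cases p q q
  ... | inj₁ (q≡p , _) = contradiction (sym (trans (sym q≡1+p) (cong toℕ q≡p))) (ℕ.<⇒≢ ℕ.≤-refl)
  ... | inj₂ (inj₁ (_ , e)) = cong suc (trans (cong toℕ e) toℕp)
  ... | inj₂ (inj₂ (_ , q≢q , _)) = contradiction refl q≢q
  swapped : ∀ y → y ≢ z →
    (pos π y ≡ suc k × pos τ y ≡ suc (suc k)) ⊎ (pos π y ≢ suc k × pos τ y ≡ pos π y)
  swapped y y≢z with transpose-cases p q (π ⟨$⟩ʳ y)
  ... | inj₁ (e , e′) =
    inj₁ (cong suc (trans (cong toℕ e) toℕp) , cong suc (trans (cong toℕ e′) toℕq))
  ... | inj₂ (inj₁ (e , _)) = contradiction (pos-injective π (cong (λ i → suc (toℕ i)) e)) y≢z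
  ... | inj₂ (inj₂ (≢p , _ , e)) =
    inj₂ ((λ e′ → ≢p (Fin.toℕ-injective (trans (ℕ.suc-injective e′) (sym toℕp)))) ,
      cong (λ i → suc (toℕ i)) e)
  before : ∀ y → ¬ y ≡ z → pos τ y < pos τ z → pos π₁ y ≡ suc (pos τ y)
  before y y≢z y<z with swapped y y≢z
  ... | inj₁ (_ , τy) = contradiction
    (ℕ.<-trans (subst₂ _<_ τy τz≡1+k y<z) ℕ.≤-refl) (ℕ.<-irrefl refl)
  ... | inj₂ (_ , τy) = trans
    (proj₁ (proj₂ F) y y≢z
      (ℕ.<-trans (subst₂ _<_ τy τz≡1+k y<z) (ℕ.≤-reflexive (sym πz≡2+k))))
    (cong suc (sym τy))
  after : ∀ y → ¬ y ≡ z → pos τ z < pos τ y → pos π₁ y ≡ pos τ y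
  after y y≢z z<y with swapped y y≢z
  ... | inj₁ (πy , τy) = trans
    (proj₁ (proj₂ F) y y≢z (subst₂ _<_ (sym πy) (sym πz≡2+k) ℕ.≤-refl))
    (trans (cong suc πy) (sym τy))
  ... | inj₂ (_ , τy) = trans
    (proj₂ (proj₂ F) y y≢z
      (ℕ.≤∧≢⇒< (subst₂ _≤_ (trans (cong suc τz≡1+k) (sym πz≡2+k)) τy z<y)
        (λ e → y≢z (sym (pos-injective π e)))))
    (sym τy)

-- `w` sits at the later swapped position and is the only element to move forward. The potential
-- does not increase with an offline position, so only the term of `w` can rise.
AdjSwap-cases : ∀ {n} (σ τ : Permutation′ n) → AdjSwap σ τ → ∃ λ w →
  pos σ w ≡ suc (pos τ w) × (∀ y → y ≢ w → pos σ y ≤ pos τ y)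
AdjSwap-cases {n} σ τ (p , q , q≡1+p , τ≡) = w , at-w , elsewhere
  where
  toℕτ : ∀ {y i} → transpose p q ⟨$⟩ʳ (σ ⟨$⟩ʳ y) ≡ i → pos τ y ≡ suc (toℕ i)
  toℕτ {y} e = cong (suc ∘ toℕ) (trans (τ≡ y) e)
  w = σ ⟨$⟩ˡ q
  σw≡q : σ ⟨$⟩ʳ w ≡ q
  σw≡q = inverseʳ σ
  at-w : pos σ w ≡ suc (pos τ w)
  at-w with transpose-cases p q (σ ⟨$⟩ʳ w)
  ... | inj₁ (e , _) =
    contradiction (sym (trans (sym q≡1+p) (cong toℕ (trans (sym σw≡q) e)))) (ℕ.<⇒≢ ℕ.≤-refl)
  ... | inj₂ (inj₁ (_ , e)) = cong suc (trans (cong toℕ σw≡q) (trans q≡1+p (sym (toℕτ e))))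
  ... | inj₂ (inj₂ (_ , ≢q , _)) = contradiction σw≡q ≢q
  elsewhere : ∀ y → y ≢ w → pos σ y ≤ pos τ y
  elsewhere y y≢w with transpose-cases p q (σ ⟨$⟩ʳ y)
  ... | inj₁ (e , e′) = ℕ.≤-trans (ℕ.n≤1+n _)
    (ℕ.≤-reflexive (trans (cong (λ i → suc (suc (toℕ i))) e)
      (trans (cong suc (sym q≡1+p)) (sym (toℕτ e′)))))
  ... | inj₂ (inj₁ (e , _)) = contradiction
    (pos-injective σ (cong (suc ∘ toℕ) (trans e (sym σw≡q)))) y≢w
  ... | inj₂ (inj₂ (_ , _ , e)) = ℕ.≤-reflexive (sym (toℕτ e))

-- Budgets after a reset.

reset-≡ : ∀ {n} (b : Budget n) z → reset b z z ≡ 0ℚ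
reset-≡ b z = cong (if_then 0ℚ else b z) (dec-true (z ≟ z) refl)

reset-≢ : ∀ {n} (b : Budget n) {y z} → y ≢ z → reset b z y ≡ b y
reset-≢ b {y} {z} y≢z = cong (if_then 0ℚ else b y) (dec-false (y ≟ z) y≢z)

0≤reset : ∀ {n} {b : Budget n} z → (∀ y → 0ℚ ℚ.≤ b y) → ∀ y → 0ℚ ℚ.≤ reset b z y
0≤reset {b = b} z 0≤b y with y ≟ z
... | yes refl = ℚ.≤-refl
... | no _ = 0≤b y

-- Natural numbers inside the rationals.

infix 9 ι_
-- Opaque because (+ n) / 1 normalises to a gcd computation on n.
opaque
  ι_ : ℕ → ℚ
  ι n = (+ n) / 1

  -- Normalised arithmetic is compared with unnormalised arithmetic through `toℚᵘ`; there an
  -- equation about `ι` is an integer cross-multiplication.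
  fromℚᵘ-homo₂ : ∀ {p q r} {_∙_ : ℚ → ℚ → ℚ} {_∙ᵘ_ : ℚᵘ.ℚᵘ → ℚᵘ.ℚᵘ → ℚᵘ.ℚᵘ} →
    (∀ x y → toℚᵘ (x ∙ y) ℚᵘ.≃ (toℚᵘ x ∙ᵘ toℚᵘ y)) →
    (∀ {x x′ y y′} → x ℚᵘ.≃ x′ → y ℚᵘ.≃ y′ → (x ∙ᵘ y) ℚᵘ.≃ (x′ ∙ᵘ y′)) →
    r ℚᵘ.≃ (p ∙ᵘ q) → fromℚᵘ r ≡ (fromℚᵘ p ∙ fromℚᵘ q)
  fromℚᵘ-homo₂ {p} {q} {r} homo ∙-cong r≃pq = ℚ.toℚᵘ-injective
    (ℚᵘ.≃-trans (ℚ.toℚᵘ-fromℚᵘ r)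
    (ℚᵘ.≃-trans r≃pq
    (ℚᵘ.≃-sym (ℚᵘ.≃-trans (homo (fromℚᵘ p) (fromℚᵘ q))
      (∙-cong (ℚ.toℚᵘ-fromℚᵘ p) (ℚ.toℚᵘ-fromℚᵘ q))))))

  ι-posℚ : ∀ {n} (π : Permutation′ n) z → posℚ π z ≡ ι pos π z
  ι-posℚ π z = refl

  ι-0 : ι 0 ≡ 0ℚ
  ι-0 = refl

  ι-1 : ι 1 ≡ 1ℚ
  ι-1 = refl

  ι-+ : ∀ m n → ι (m + n) ≡ ι m ℚ.+ ι n
  ι-+ m n = fromℚᵘ-homo₂ {mkℚᵘ (+ m) 0} {mkℚᵘ (+ n) 0} {mkℚᵘ (+ (m + n)) 0}
    ℚ.toℚᵘ-homo-+ ℚᵘ.+-cong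
    (*≡* (cong (ℤ._* + 1) (sym (cong₂ ℤ._+_ (ℤ.*-identityʳ (+ m)) (ℤ.*-identityʳ (+ n))))))

  ι-* : ∀ m n → ι (m * n) ≡ ι m ℚ.* ι n
  ι-* m n = fromℚᵘ-homo₂ {mkℚᵘ (+ m) 0} {mkℚᵘ (+ n) 0} {mkℚᵘ (+ (m * n)) 0}
    ℚ.toℚᵘ-homo-* ℚᵘ.*-cong
    (*≡* (cong (ℤ._* + 1) (ℤ.pos-* m n)))

  /-*-cancel : ∀ m k → ((+ m) / suc k) ℚ.* ι (suc k) ≡ ι m
  /-*-cancel m k = sym (fromℚᵘ-homo₂ {mkℚᵘ (+ m) k} {mkℚᵘ (+ suc k) 0} {mkℚᵘ (+ m) 0}
    ℚ.toℚᵘ-homo-* ℚᵘ.*-cong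
    (*≡* (trans (cong (λ d → + m ℤ.* + d) (ℕ.*-identityʳ (suc k)))
      (sym (ℤ.*-identityʳ _)))))

  ι-mono-≤ : ∀ {m n} → m ≤ n → ι m ℚ.≤ ι n
  ι-mono-≤ {m} {n} m≤n = ℚ.toℚᵘ-cancel-≤
    (ℚᵘ.≤-respˡ-≃ (ℚᵘ.≃-sym (ℚ.toℚᵘ-fromℚᵘ (mkℚᵘ (+ m) 0)))
    (ℚᵘ.≤-respʳ-≃ (ℚᵘ.≃-sym (ℚ.toℚᵘ-fromℚᵘ (mkℚᵘ (+ n) 0)))
    (*≤* (ℤ.*-monoʳ-≤-nonNeg (+ 1) (ℤ.+≤+ m≤n)))))

  ι-cancel-≤ : ∀ {m n} → ι m ℚ.≤ ι n → m ≤ n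
  ι-cancel-≤ {m} {n} ιm≤ιn with m ℕ.≤? n
  ... | yes m≤n = m≤n
  ... | no m≰n = contradiction (ℚᵘ.drop-*≤* (ℚᵘ.≤-respˡ-≃ (ℚ.toℚᵘ-fromℚᵘ (mkℚᵘ (+ m) 0))
     (ℚᵘ.≤-respʳ-≃ (ℚ.toℚᵘ-fromℚᵘ (mkℚᵘ (+ n) 0)) (ℚ.toℚᵘ-mono-≤ ιm≤ιn))))
     λ h → m≰n (ℤ.drop‿+≤+ (subst₂ ℤ._≤_ (ℤ.*-identityʳ _) (ℤ.*-identityʳ _) h))

-- Rational inequalities and finite sums.

0≤ι : ∀ n → 0ℚ ℚ.≤ ι n
0≤ι n = subst (ℚ._≤ ι n) ι-0 (ι-mono-≤ (z≤n {n}))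

0≤+ : ∀ {x y} → 0ℚ ℚ.≤ x → 0ℚ ℚ.≤ y → 0ℚ ℚ.≤ x ℚ.+ y
0≤+ = ℚ.+-mono-≤

0≤* : ∀ {x y} → 0ℚ ℚ.≤ x → 0ℚ ℚ.≤ y → 0ℚ ℚ.≤ x ℚ.* y
0≤* {x} {y} 0≤x 0≤y = ℚ.nonNegative⁻¹ (x ℚ.* y)
  {{ℚ.nonNeg*nonNeg⇒nonNeg x {{ℚ.nonNegative 0≤x}} y {{ℚ.nonNegative 0≤y}}}}

0≤- : ∀ {x y} → x ℚ.≤ y → 0ℚ ℚ.≤ y ℚ.- x
0≤- {x} {y} x≤y = subst (ℚ._≤ y ℚ.- x) (ℚ.+-inverseʳ x) (ℚ.+-monoˡ-≤ (ℚ.- x) x≤y)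

-- Linear inequalities are derived by writing the slack as a nonnegative
-- combination of the hypotheses, which leaves a ring identity.
slack⇒≤ : ∀ {x y s} → 0ℚ ℚ.≤ s → x ℚ.+ s ≡ y → x ℚ.≤ y
slack⇒≤ {x} {_} {s} 0≤s refl = subst (ℚ._≤ x ℚ.+ s) (ℚ.+-identityʳ x) (ℚ.+-monoʳ-≤ x 0≤s)

sum-mono-≤ : ∀ {n} {f g : Fin n → ℚ} → (∀ i → f i ℚ.≤ g i) → sum f ℚ.≤ sum g
sum-mono-≤ {zero} f≤g = ℚ.≤-refl
sum-mono-≤ {suc n} f≤g = ℚ.+-mono-≤ (f≤g zero) (sum-mono-≤ (f≤g ∘ suc))

-- Isolates the one element whose change is special: the fetched one, the one accessed offline, or
-- the one swapped forward offline. In the last case `d` is negative.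
sum-mono-≤-at : ∀ {n} {f g : Fin n → ℚ} u {d} → (∀ i → i ≢ u → f i ℚ.≤ g i) →
  f u ℚ.+ d ℚ.≤ g u → sum f ℚ.+ d ℚ.≤ sum g
sum-mono-≤-at {suc n} {f} {g} zero {d} f≤g fu = ℚ.≤-trans
  (ℚ.≤-reflexive (solve 3 (λ a b c → (a :+ b) :+ c := (a :+ c) :+ b) refl
    (f zero) (sum (f ∘ suc)) d))
  (ℚ.+-mono-≤ fu (sum-mono-≤ λ i → f≤g (suc i) λ ()))
sum-mono-≤-at {suc n} {f} {g} (suc u) {d} f≤g fu = ℚ.≤-trans
  (ℚ.≤-reflexive (ℚ.+-assoc (f zero) (sum (f ∘ suc)) d))
  (ℚ.+-mono-≤ (f≤g zero λ ()) (sum-mono-≤-at u (λ i i≢u → f≤g (suc i) λ { refl → i≢u refl }) fu))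

sum-const-0 : ∀ {n} {f : Fin n → ℚ} → (∀ i → f i ≡ 0ℚ) → sum f ≡ 0ℚ
sum-const-0 {zero} f≡0 = refl
sum-const-0 {suc n} f≡0 = cong₂ ℚ._+_ (f≡0 zero) (sum-const-0 (f≡0 ∘ suc))

sum-nonneg : ∀ {n} {f : Fin n → ℚ} → (∀ i → 0ℚ ℚ.≤ f i) → 0ℚ ℚ.≤ sum f
sum-nonneg {n} 0≤f = ℚ.≤-trans
  (ℚ.≤-reflexive (sym (sum-const-0 {n} {λ _ → 0ℚ} λ _ → refl))) (sum-mono-≤ 0≤f)

sum-subset : ∀ {n} (R : Subset n) δ →
  sum (λ y → if lookup R y then δ else 0ℚ) ≡ ι ∣ R ∣ ℚ.* δ
sum-subset [] δ = sym (trans (cong (ℚ._* δ) ι-0) (ℚ.*-zeroˡ δ))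
sum-subset (true ∷ R) δ = trans (cong (δ ℚ.+_) (sum-subset R δ))
  (trans (solve 2 (λ s δ → δ :+ s :* δ := (con 1ℚ :+ s) :* δ) refl (ι ∣ R ∣) δ)
    (cong (ℚ._* δ) (sym (trans (ι-+ 1 ∣ R ∣) (cong (ℚ._+ ι ∣ R ∣) ι-1)))))
sum-subset (false ∷ R) δ = trans (ℚ.+-identityˡ _) (sum-subset R δ)

-- The rise caused by a fetch, charged to offline positions.

opaque
  -- Bounds the rise of the term of an element at offline position `q` when a fetch from position
  -- `P` moves it back; used with c = 4γ.
  charge : ℕ → ℕ → ℕ → ℚ
  charge c P q = if does (c * q ℕ.≤? P) then ι c else 0ℚ

  charge-cases : ∀ c P q →
    (c * q ≤ P × charge c P q ≡ ι c) ⊎ (P < c * q × charge c P q ≡ 0ℚ)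
  charge-cases c P q with c * q ℕ.≤? P
  ... | yes h = inj₁ (h , cong (if_then ι c else 0ℚ) (dec-true (c * q ℕ.≤? P) h))
  ... | no h = inj₂ (ℕ.≰⇒> h , cong (if_then ι c else 0ℚ) (dec-false (c * q ℕ.≤? P) h))

0≤charge : ∀ c P q → 0ℚ ℚ.≤ charge c P q
0≤charge c P q with charge-cases c P q
... | inj₁ (_ , e) = subst (0ℚ ℚ.≤_) (sym e) (0≤ι c)
... | inj₂ (_ , e) = ℚ.≤-reflexive (sym e)

charge≤ι : ∀ c P q → charge c P q ℚ.≤ ι c
charge≤ι c P q with charge-cases c P q
... | inj₁ (_ , e) = ℚ.≤-reflexive e
... | inj₂ (_ , e) = subst (ℚ._≤ ι c) (sym e) (0≤ι c)

charge-shift : ∀ c P q → charge c (c + P) (suc q) ≡ charge c P q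
charge-shift c P q with charge-cases c P q | charge-cases c (c + P) (suc q)
... | inj₁ (_ , e) | inj₁ (_ , e′) = trans e′ (sym e)
... | inj₂ (_ , e) | inj₂ (_ , e′) = trans e′ (sym e)
... | inj₁ (h , _) | inj₂ (h′ , _) = contradiction (ℕ.+-monoʳ-≤ c h)
  (ℕ.<⇒≱ (subst (c + P <_) (ℕ.*-suc c q) h′))
... | inj₂ (h , _) | inj₁ (h′ , _) = contradiction
  (ℕ.+-cancelˡ-≤ c _ _ (subst (_≤ c + P) (ℕ.*-suc c q) h′)) (ℕ.<⇒≱ h)

-- Dropping the first index shifts the rest by one, which by `charge-shift` amounts to lowering `P`
-- by `c`. Once c > P no index is charged.
sum-charge-toℕ : ∀ n c P → sum {n} (λ i → charge c P (suc (toℕ i))) ℚ.≤ ι P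
sum-charge-toℕ zero c P = 0≤ι P
sum-charge-toℕ (suc n) c P with c ℕ.≤? P
... | yes c≤P = subst (λ P → sum {suc n} (λ i → charge c P (suc (toℕ i))) ℚ.≤ ι P)
  (ℕ.m+[n∸m]≡n c≤P) (ℚ.≤-trans (ℚ.+-mono-≤ (charge≤ι c (c + P′) 1)
    (ℚ.≤-trans (sum-mono-≤ {n} λ i → ℚ.≤-reflexive (charge-shift c P′ (suc (toℕ i))))
      (sum-charge-toℕ n c P′)))
    (ℚ.≤-reflexive (sym (ι-+ c P′))))
  where P′ = P ∸ c
... | no c≰P = ℚ.≤-trans (ℚ.≤-reflexive (sum-const-0 {suc n} uncharged)) (0≤ι P)
  where
  uncharged : ∀ (i : Fin (suc n)) → charge c P (suc (toℕ i)) ≡ 0ℚ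
  uncharged i with charge-cases c P (suc (toℕ i))
  ... | inj₁ (h , _) = contradiction (ℕ.≤-trans (ℕ.m≤m*n c (suc (toℕ i))) h) c≰P
  ... | inj₂ (_ , e) = e

sum-charge : ∀ {n} c P (π : Permutation′ n) → sum (λ y → charge c P (pos π y)) ℚ.≤ ι P
sum-charge {n} c P π = subst (ℚ._≤ ι P)
  (sum-permute (λ i → charge c P (suc (toℕ i))) π) (sum-charge-toℕ n c P)

-- The potential of a single element, for any γ ≥ 0.

opaque
  excess : ℚ → ℚ → ℚ → ℚ → ℚ
  excess γ p q b = ι 4 ℚ.* γ ℚ.* (p ℚ.- ι 4 ℚ.* γ ℚ.* q) ℚ.- γ ℚ.* b

  φ : ℚ → ℚ → ℚ → ℚ → ℚ
  φ γ p q b = b ℚ.+ b ℚ.+ (0ℚ ℚ.⊔ excess γ p q b)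

module _ (γ : ℚ) (0≤γ : 0ℚ ℚ.≤ γ) where

  opaque
    -- Unfolding `ι_` lets the ring solver compute with numerals such as `ι 8`.
    unfolding ι_ φ

    0≤4γ : 0ℚ ℚ.≤ ι 4 ℚ.* γ
    0≤4γ = 0≤* (0≤ι 4) 0≤γ

    φ-lower : ∀ p q b → b ℚ.+ b ℚ.≤ φ γ p q b
    φ-lower p q b = slack⇒≤ (ℚ.p≤p⊔q 0ℚ (excess γ p q b)) refl

    0≤φ : ∀ p q {b} → 0ℚ ℚ.≤ b → 0ℚ ℚ.≤ φ γ p q b
    0≤φ p q {b} 0≤b = ℚ.≤-trans (0≤+ 0≤b 0≤b) (φ-lower p q b)

    excess≤φ : ∀ p q {b} → 0ℚ ℚ.≤ b → excess γ p q b ℚ.≤ φ γ p q b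
    excess≤φ p q {b} 0≤b = ℚ.≤-trans (ℚ.p≤q⊔p 0ℚ (excess γ p q b))
      (slack⇒≤ (0≤+ 0≤b 0≤b) (ℚ.+-comm _ (b ℚ.+ b)))

    φ-upper : ∀ p q b {x} → 0ℚ ℚ.≤ x → excess γ p q b ℚ.≤ x → φ γ p q b ℚ.≤ b ℚ.+ b ℚ.+ x
    φ-upper _ _ b 0≤x e≤x = ℚ.+-monoʳ-≤ (b ℚ.+ b) (ℚ.⊔-lub 0≤x e≤x)

    φ-settled : ∀ p q {b} → 0ℚ ℚ.≤ b → p ℚ.≤ ι 4 ℚ.* γ ℚ.* q → φ γ p q b ℚ.≤ b ℚ.+ b
    φ-settled p q {b} 0≤b p≤4γq = ℚ.≤-trans
      (φ-upper p q b ℚ.≤-refl (slack⇒≤ (0≤+ (0≤* 0≤4γ (0≤- p≤4γq)) (0≤* 0≤γ 0≤b))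
        (solve 4 (λ c γ p d → c :* (p :- d) :- γ :+ (c :* (d :- p) :+ γ) := con 0ℚ) refl
          (ι 4 ℚ.* γ) (γ ℚ.* b) p (ι 4 ℚ.* γ ℚ.* q))))
      (ℚ.≤-reflexive (ℚ.+-identityʳ (b ℚ.+ b)))

    -- Since max(0, e + d) ≤ max(0, e) + d for d ≥ 0, a change of the potential is bounded by the
    -- change of the linear `excess` and that of 2b.
    φ-step : ∀ p p′ q q′ b b′ {d} → 0ℚ ℚ.≤ d →
      excess γ p′ q′ b′ ℚ.≤ excess γ p q b ℚ.+ d →
      φ γ p′ q′ b′ ℚ.≤ φ γ p q b ℚ.+ d ℚ.+ (b′ ℚ.+ b′ ℚ.- (b ℚ.+ b))
    φ-step p p′ q q′ b b′ {d} 0≤d h = ℚ.≤-trans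
      (φ-upper p′ q′ b′ (0≤+ (ℚ.p≤p⊔q 0ℚ (excess γ p q b)) 0≤d)
        (ℚ.≤-trans h (ℚ.+-monoˡ-≤ d (ℚ.p≤q⊔p 0ℚ (excess γ p q b)))))
      (ℚ.≤-reflexive (solve 4 (λ b b′ d m → (b′ :+ b′) :+ (m :+ d) :=
          ((b :+ b) :+ m) :+ d :+ ((b′ :+ b′) :- (b :+ b))) refl b b′ d (0ℚ ℚ.⊔ excess γ p q b)))

    φ-step-≡ : ∀ p p′ q q′ b {d} → 0ℚ ℚ.≤ d →
      excess γ p′ q′ b ℚ.≤ excess γ p q b ℚ.+ d →
      φ γ p′ q′ b ℚ.≤ φ γ p q b ℚ.+ d
    φ-step-≡ p p′ q q′ b {d} 0≤d h = ℚ.≤-trans (φ-step p p′ q q′ b b 0≤d h)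
      (ℚ.≤-reflexive (solve 2 (λ x b → x :+ (b :- b) := x) refl (φ γ p q b ℚ.+ d) (b ℚ.+ b)))

    φ-back : ∀ p q b → φ γ (ι 1 ℚ.+ p) q b ℚ.≤ φ γ p q b ℚ.+ ι 4 ℚ.* γ
    φ-back p q b = φ-step-≡ p (ι 1 ℚ.+ p) q q b 0≤4γ (ℚ.≤-reflexive
      (solve 4 (λ c p d e → c :* ((con (ι 1) :+ p) :- d) :- e := c :* (p :- d) :- e :+ c) refl
        (ι 4 ℚ.* γ) p (ι 4 ℚ.* γ ℚ.* q) (γ ℚ.* b)))

    φ-antitone : ∀ p b {q q′} → q ℚ.≤ q′ → φ γ p q′ b ℚ.≤ φ γ p q b
    φ-antitone p b {q} {q′} q≤q′ = ℚ.≤-trans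
      (φ-step-≡ p p q q′ b ℚ.≤-refl (slack⇒≤ (0≤* 0≤4γ (0≤* 0≤4γ (0≤- q≤q′)))
        (solve 5 (λ c p q q′ e → c :* (p :- c :* q′) :- e :+ c :* (c :* (q′ :- q)) :=
            c :* (p :- c :* q) :- e :+ con 0ℚ) refl (ι 4 ℚ.* γ) p q q′ (γ ℚ.* b))))
      (ℚ.≤-reflexive (ℚ.+-identityʳ _))

    φ-opt-back : ∀ p q b →
      φ γ p q b ℚ.≤ φ γ p (ι 1 ℚ.+ q) b ℚ.+ ι 4 ℚ.* γ ℚ.* (ι 4 ℚ.* γ)
    φ-opt-back p q b = φ-step-≡ p p (ι 1 ℚ.+ q) q b (0≤* 0≤4γ 0≤4γ) (ℚ.≤-reflexive
      (solve 4 (λ c p q e → c :* (p :- c :* q) :- e :=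
        c :* (p :- c :* (con (ι 1) :+ q)) :- e :+ c :* c) refl (ι 4 ℚ.* γ) p q (γ ℚ.* b)))

    φ-budget : ∀ p q b {δ} → 0ℚ ℚ.≤ δ → φ γ p q (b ℚ.+ δ) ℚ.≤ φ γ p q b ℚ.+ (δ ℚ.+ δ)
    φ-budget p q b {δ} 0≤δ = ℚ.≤-trans
      (φ-step p p q q b (b ℚ.+ δ) ℚ.≤-refl (slack⇒≤ (0≤* 0≤γ 0≤δ)
        (solve 4 (λ e γ b δ → e :- γ :* (b :+ δ) :+ γ :* δ := e :- γ :* b :+ con 0ℚ) refl
          (ι 4 ℚ.* γ ℚ.* (p ℚ.- ι 4 ℚ.* γ ℚ.* q)) γ b δ)))
      (ℚ.≤-reflexive (solve 3 (λ x b δ → x :+ con 0ℚ :+ (((b :+ δ) :+ (b :+ δ)) :- (b :+ b)) :=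
        x :+ (δ :+ δ)) refl (φ γ p q b) b δ))

    -- From 8γq ≤ p follows 4γ(p - 4γq) ≥ 2γp, and γb takes away at most γp of it.
    excess-large : ∀ p q b → b ℚ.≤ p → ι 8 ℚ.* γ ℚ.* q ℚ.≤ p → γ ℚ.* p ℚ.≤ excess γ p q b
    excess-large p q b b≤p 8γq≤p = slack⇒≤
      (0≤+ (0≤* 0≤γ (0≤- b≤p)) (0≤* (0≤* (0≤ι 2) 0≤γ) (0≤- 8γq≤p)))
      (solve 4 (λ γ p q b → γ :* p :+
          (γ :* (p :- b) :+ con (ι 2) :* γ :* (p :- con (ι 8) :* γ :* q)) :=
        con (ι 4) :* γ :* (p :- con (ι 4) :* γ :* q) :- γ :* b) refl γ p q b)

    -- The extra budget lowers `excess` by γδ ≥ e. As `excess` starts at γp ≥ e or more, truncation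
    -- at zero does not swallow any of the drop `e`.
    φ-budget-large : ∀ p q b {δ e} → 0ℚ ℚ.≤ e → b ℚ.≤ p → ι 8 ℚ.* γ ℚ.* q ℚ.≤ p →
      e ℚ.≤ γ ℚ.* p → e ℚ.≤ γ ℚ.* δ →
      φ γ p q (b ℚ.+ δ) ℚ.+ e ℚ.≤ φ γ p q b ℚ.+ (δ ℚ.+ δ)
    φ-budget-large p q b {δ} {e} 0≤e b≤p 8γq≤p e≤γp e≤γδ = ℚ.≤-trans
      (ℚ.+-monoˡ-≤ e (φ-upper p q (b ℚ.+ δ) (0≤- (ℚ.≤-trans e≤γp γp≤X))
        (slack⇒≤ (0≤- e≤γδ)
          (solve 5 (λ a γ b δ e → a :- γ :* (b :+ δ) :+ (γ :* δ :- e) := a :- γ :* b :- e) refl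
            (ι 4 ℚ.* γ ℚ.* (p ℚ.- ι 4 ℚ.* γ ℚ.* q)) γ b δ e))))
      (ℚ.≤-trans
        (ℚ.≤-reflexive (solve 4 (λ b δ x e → (b :+ δ) :+ (b :+ δ) :+ (x :- e) :+ e :=
          b :+ b :+ x :+ (δ :+ δ)) refl b δ X e))
        (ℚ.+-monoˡ-≤ (δ ℚ.+ δ) (ℚ.+-monoʳ-≤ (b ℚ.+ b) (ℚ.p≤q⊔p 0ℚ X))))
      where
      X : ℚ
      X = excess γ p q b
      γp≤X : γ ℚ.* p ℚ.≤ X
      γp≤X = excess-large p q b b≤p 8γq≤p

-- Unrolls the multiple so that 5ℓ and ℓ share the atom `ι ℓ` in ring identities.
ι-5* : ∀ n → ι (5 * n) ≡ ι n ℚ.+ (ι n ℚ.+ (ι n ℚ.+ (ι n ℚ.+ ι n)))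
ι-5* n = trans (cong ι_ (unroll n)) (trans (ι-+ n _) (cong (ι n ℚ.+_)
  (trans (ι-+ n _) (cong (ι n ℚ.+_) (trans (ι-+ n _) (cong (ι n ℚ.+_) (ι-+ n n)))))))
  where
  unroll : ∀ n → 5 * n ≡ n + (n + (n + (n + n)))
  unroll = solve-∀

-- Constants and the potential at list positions.

module Amortisation (r : ℕ) (1≤r : 1 ≤ r) where

  opaque
    -- These are γ, 4γ and (4γ)²; the last is the rate at which offline cost is charged.
    g c K : ℕ
    g = 5 * r
    c = 4 * g
    K = 400 * r ^ 2

    g≡5r : g ≡ 5 * r
    g≡5r = refl

    K≡400r² : K ≡ 400 * r ^ 2
    K≡400r² = refl

    1≤c : 1 ≤ c
    1≤c = ℕ.*-mono-≤ {1} {4} (s≤s z≤n) (ℕ.*-mono-≤ {1} {5} (s≤s z≤n) 1≤r)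

    ιc≡4γ : ι c ≡ ι 4 ℚ.* ι g
    ιc≡4γ = ι-* 4 g

    c*c≡K : c * c ≡ K
    c*c≡K = square r
      where
      square : ∀ r → 4 * (5 * r) * (4 * (5 * r)) ≡ 400 * (r * (r * 1))
      square = solve-∀

    -- The left side is 200rq, and r ≤ r² because 1 ≤ r. It settles requests with ℓ ≤ 8γq.
    5*[8*g*q]≤K*q : ∀ q → 5 * (8 * g * q) ≤ K * q
    5*[8*g*q]≤K*q q = subst (_≤ K * q) (regroup r q)
      (ℕ.*-monoˡ-≤ q (ℕ.*-mono-≤ {200} {400} (ℕ.m≤m+n 200 200)
        (subst (_≤ r ^ 2) (ℕ.*-identityʳ r)
          (ℕ.*-monoʳ-≤ r (subst (1 ≤_) (sym (ℕ.*-identityʳ r)) 1≤r)))))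
      where
      regroup : ∀ r q → 200 * r * q ≡ 5 * (8 * (5 * r) * q)
      regroup = solve-∀

  γ : ℚ
  γ = ι g

  0≤γ : 0ℚ ℚ.≤ γ
  0≤γ = 0≤ι g

  4γ*4γ≡ιK : ι 4 ℚ.* γ ℚ.* (ι 4 ℚ.* γ) ≡ ι K
  4γ*4γ≡ιK = trans (sym (cong₂ ℚ._*_ ιc≡4γ ιc≡4γ)) (trans (sym (ι-* c c)) (cong ι_ c*c≡K))

  ≤4γι : ∀ {p q} → p ≤ c * q → ι p ℚ.≤ ι 4 ℚ.* γ ℚ.* ι q
  ≤4γι {p} {q} h = ℚ.≤-trans (ι-mono-≤ h)
    (ℚ.≤-reflexive (trans (ι-* c q) (cong (ℚ._* ι q) ιc≡4γ)))

  ψ : ℕ → ℕ → ℚ → ℚ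
  ψ p q b = φ γ (ι p) (ι q) b

  0≤ψ : ∀ p q {b} → 0ℚ ℚ.≤ b → 0ℚ ℚ.≤ ψ p q b
  0≤ψ p q = 0≤φ γ 0≤γ (ι p) (ι q)

  ψ-settled : ∀ p q → p ≤ c * q → ψ p q 0ℚ ℚ.≤ 0ℚ
  ψ-settled p q h = φ-settled γ 0≤γ (ι p) (ι q) ℚ.≤-refl (≤4γι h)

  -- Offline positions are at least 1 and c ≥ 1, so a freshly fetched element carries no potential.
  ψ-front : ∀ q → ψ 1 (suc q) 0ℚ ℚ.≤ 0ℚ
  ψ-front q = ψ-settled 1 (suc q) (ℕ.*-mono-≤ 1≤c (s≤s (z≤n {q})))

  -- If 4γq ≤ P, one step back adds at most 4γ. Otherwise p + 1 ≤ P < 4γq, so the max vanishes even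
  -- at the new position and only 2b is left.
  ψ-back : ∀ p {P} q b → 0ℚ ℚ.≤ b → p < P → ψ (suc p) q b ℚ.≤ ψ p q b ℚ.+ charge c P q
  ψ-back p {P} q b 0≤b p<P with charge-cases c P q
  ... | inj₁ (_ , e) = subst₂ (λ p′ d → φ γ p′ (ι q) b ℚ.≤ ψ p q b ℚ.+ d)
    (sym (ι-+ 1 p)) (sym (trans e ιc≡4γ)) (φ-back γ 0≤γ (ι p) (ι q) b)
  ... | inj₂ (P<cq , _) = ℚ.≤-trans
    (φ-settled γ 0≤γ (ι suc p) (ι q) 0≤b (≤4γι (ℕ.≤-trans p<P (ℕ.<⇒≤ P<cq))))
    (ℚ.≤-trans (φ-lower γ 0≤γ (ι p) (ι q) b) (slack⇒≤ (0≤charge c P q) refl))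

  ψ-Fetch : ∀ {n} (π π₁ : Permutation′ n) {z} → Fetch π z π₁ → ∀ {y} → y ≢ z →
    ∀ q b → 0ℚ ℚ.≤ b → ψ (pos π₁ y) q b ℚ.≤ ψ (pos π y) q b ℚ.+ charge c (pos π z) q
  ψ-Fetch π π₁ {z} F {y} y≢z q b 0≤b with Fetch-cases π {π₁} F y y≢z
  ... | inj₁ (y<z , e) = subst (λ p → ψ p q b ℚ.≤ ψ (pos π y) q b ℚ.+ charge c (pos π z) q)
    (sym e) (ψ-back (pos π y) q b 0≤b y<z)
  ... | inj₂ (_ , e) = subst (λ p → ψ p q b ℚ.≤ ψ (pos π y) q b ℚ.+ charge c (pos π z) q)
    (sym e) (slack⇒≤ (0≤charge c (pos π z) q) refl)

  -- The total potential, fetches and the cleanup loop.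

  Φ : ∀ {n} → Permutation′ n → Permutation′ n → Budget n → ℚ
  Φ π σ b = sum λ y → ψ (pos π y) (pos σ y) (b y)

  0≤Φ : ∀ {n} (π σ : Permutation′ n) {b} → (∀ y → 0ℚ ℚ.≤ b y) → 0ℚ ℚ.≤ Φ π σ b
  0≤Φ π σ 0≤b = sum-nonneg λ y → 0≤ψ (pos π y) (pos σ y) (0≤b y)

  -- Equal lists give p ≤ 4γp at every element. This is what makes the competitive bound strict,
  -- without an additive term.
  Φ-initial : ∀ {n} (π : Permutation′ n) → Φ π π (λ _ → 0ℚ) ℚ.≤ 0ℚ
  Φ-initial {n} π = ℚ.≤-trans
    (sum-mono-≤ {g = λ _ → 0ℚ} λ y → ψ-settled (pos π y) (pos π y)
      (subst (_≤ c * pos π y) (ℕ.*-identityˡ (pos π y)) (ℕ.*-monoˡ-≤ (pos π y) 1≤c)))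
    (ℚ.≤-reflexive (sum-const-0 {n} λ _ → refl))

  -- The fetched element releases at least 2P; the other terms absorb at most P, and the remaining P
  -- is left for the swaps.
  Φ-fetch : ∀ {n} (π π₁ σ : Permutation′ n) {b z} → (∀ y → 0ℚ ℚ.≤ b y) →
    ι pos π z ℚ.≤ b z → Fetch π z π₁ →
    Φ π₁ σ (reset b z) ℚ.+ ι pos π z ℚ.≤ Φ π σ b
  Φ-fetch π π₁ σ {b} {z} 0≤b P≤b F = slack⇒≤ (0≤- total)
    (solve 3 (λ x p y → x :+ p :+ ((y :+ p) :- (x :+ (p :+ p))) := y) refl
      (Φ π₁ σ (reset b z)) P (Φ π σ b))
    where
    P = ι pos π z
    others : ∀ y → y ≢ z → ψ (pos π₁ y) (pos σ y) (reset b z y) ℚ.≤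
      ψ (pos π y) (pos σ y) (b y) ℚ.+ charge c (pos π z) (pos σ y)
    others y y≢z rewrite reset-≢ b y≢z = ψ-Fetch π π₁ F y≢z (pos σ y) (b y) (0≤b y)
    fetched : ψ (pos π₁ z) (pos σ z) (reset b z z) ℚ.+ (P ℚ.+ P) ℚ.≤
      ψ (pos π z) (pos σ z) (b z) ℚ.+ charge c (pos π z) (pos σ z)
    fetched rewrite reset-≡ b z | proj₁ F = ℚ.≤-trans
      (ℚ.+-mono-≤ (ψ-front _) (ℚ.+-mono-≤ P≤b P≤b))
      (ℚ.≤-trans (ℚ.≤-reflexive (ℚ.+-identityˡ (b z ℚ.+ b z)))
      (ℚ.≤-trans (φ-lower γ 0≤γ P (ι pos σ z) (b z))
        (slack⇒≤ (0≤charge c (pos π z) (pos σ z)) refl)))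
    total : Φ π₁ σ (reset b z) ℚ.+ (P ℚ.+ P) ℚ.≤ Φ π σ b ℚ.+ P
    total = ℚ.≤-trans (sum-mono-≤-at z others fetched)
      (ℚ.≤-trans (ℚ.≤-reflexive (∑-distrib-+ _ (λ y → charge c (pos π z) (pos σ y))))
        (ℚ.+-monoʳ-≤ (Φ π σ b) (sum-charge c (pos π z) σ)))

  Cleanup-amortised : ∀ {n} (π σ : Permutation′ n) {b π′ b′} → Cleanup π b π′ b′ →
    (∀ y → 0ℚ ℚ.≤ b y) →
    ∃ λ j → Swaps π π′ j × ι j ℚ.+ Φ π′ σ b′ ℚ.≤ Φ π σ b ×
      (∀ y → 0ℚ ℚ.≤ b′ y) × (∀ y → b′ y ℚ.< posℚ π′ y)
  Cleanup-amortised π σ {b} (stop b<pos) 0≤b =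
    0 , none (λ _ → refl) ,
    ℚ.≤-reflexive (trans (cong (ℚ._+ Φ π σ b) ι-0) (ℚ.+-identityˡ (Φ π σ b))) ,
    0≤b , b<pos
  Cleanup-amortised π σ {b} {π′} {b′} (fetch {π₁ = π₁} z P≤b F C) 0≤b =
    let j , s , bound , inv = Cleanup-amortised π₁ σ C (0≤reset z 0≤b)
        P = pos π z
    in toℕ (π ⟨$⟩ʳ z) + j , Swaps-trans (Fetch⇒Swaps _ {π} refl F) s ,
      -- The fetch uses P - 1 swaps; it is accounted for as P.
      ℚ.≤-trans (ℚ.+-monoˡ-≤ (Φ π′ σ b′) (ι-mono-≤ (ℕ.n≤1+n (toℕ (π ⟨$⟩ʳ z) + j))))
        (slack⇒≤ (0≤+ (0≤- bound) (0≤- (Φ-fetch π π₁ σ 0≤b (subst (ℚ._≤ b z) (ι-posℚ π z) P≤b) F)))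
          (trans (cong (λ v → v ℚ.+ Φ π′ σ b′ ℚ.+ ((Φ π₁ σ (reset b z) ℚ.- (ι j ℚ.+ Φ π′ σ b′)) ℚ.+
                    (Φ π σ b ℚ.- (Φ π₁ σ (reset b z) ℚ.+ ι P)))) (ι-+ P j))
            (solve 5 (λ p j x y w → p :+ j :+ x :+ ((y :- (j :+ x)) :+ (w :- (y :+ p))) := w)
              refl (ι P) (ι j) (Φ π′ σ b′) (Φ π₁ σ (reset b z)) (Φ π σ b)))) ,
      inv

  -- Serving a request.

  DLM-budget : ∀ {n} → Subset n → Budget n → Fin n → ℚ → Budget n
  DLM-budget R b x δ y = if does (y ≟ x) then 0ℚ else (if lookup R y then b y ℚ.+ δ else b y)

  module Request {n} (R : Subset n) (π π₁ σ : Permutation′ n) {b : Budget n} {x : Fin n} {δ : ℚ}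
    (0≤b : ∀ y → 0ℚ ℚ.≤ b y) (b<pos : ∀ y → b y ℚ.< posℚ π y)
    (x-min : MinIn π R x) (F : Fetch π x π₁)
    (0≤δ : 0ℚ ℚ.≤ δ) (Rδ≡ℓ : ι ∣ R ∣ ℚ.* δ ≡ ι pos π x) (∣R∣≤r : ∣ R ∣ ≤ r)
    where

    ℓ = pos π x
    b₁ = DLM-budget R b x δ

    -- The allowed rise of each term: its charge for the move, and 2δ for the budget. Including the
    -- fetched `x` among the requested elements makes the second parts add up to exactly 2ℓ.
    gain : Fin n → ℚ
    gain y = charge c ℓ (pos σ y) ℚ.+ (if lookup R y then δ ℚ.+ δ else 0ℚ)

    before after : Fin n → ℚ
    before y = ψ (pos π y) (pos σ y) (b y)
    after y = ψ (pos π₁ y) (pos σ y) (b₁ y)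

    0≤gain : ∀ y → 0ℚ ℚ.≤ gain y
    0≤gain y with lookup R y
    ... | true = 0≤+ (0≤charge c ℓ (pos σ y)) (0≤+ 0≤δ 0≤δ)
    ... | false = 0≤+ (0≤charge c ℓ (pos σ y)) ℚ.≤-refl

    after-x : after x ℚ.≤ 0ℚ
    after-x rewrite proj₁ F | dec-true (x ≟ x) refl = ψ-front _

    -- The budget is raised first, at the old position, and the element is moved back afterwards.
    -- `d` is 0 in general and 5ℓ for the element accessed offline.
    after-≢ : ∀ {y} → y ≢ x → ∀ {d} →
      ψ (pos π y) (pos σ y) (if lookup R y then b y ℚ.+ δ else b y) ℚ.+ d ℚ.≤
        before y ℚ.+ (if lookup R y then δ ℚ.+ δ else 0ℚ) →
      after y ℚ.+ d ℚ.≤ before y ℚ.+ gain y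
    after-≢ {y} y≢x {d} h rewrite dec-false (y ≟ x) y≢x = slack⇒≤
      (0≤+ (0≤- (ψ-Fetch π π₁ F y≢x (pos σ y) b′ 0≤b′)) (0≤- h))
      (solve 6 (λ a d m e v w → a :+ d :+ ((m :+ e :- a) :+ (v :+ w :- (m :+ d))) := v :+ (e :+ w))
        refl (ψ (pos π₁ y) (pos σ y) b′) d (ψ (pos π y) (pos σ y) b′) (charge c ℓ (pos σ y))
        (before y) (if lookup R y then δ ℚ.+ δ else 0ℚ))
      where
      b′ = if lookup R y then b y ℚ.+ δ else b y
      0≤b′ : 0ℚ ℚ.≤ b′
      0≤b′ with lookup R y
      ... | true = 0≤+ (0≤b y) 0≤δ
      ... | false = 0≤b y

    after≤ : ∀ y → after y ℚ.+ 0ℚ ℚ.≤ before y ℚ.+ gain y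
    after≤ y = by-cases (y ≟ x)
      where
      budgeted : ψ (pos π y) (pos σ y) (if lookup R y then b y ℚ.+ δ else b y) ℚ.+ 0ℚ ℚ.≤
        before y ℚ.+ (if lookup R y then δ ℚ.+ δ else 0ℚ)
      budgeted with lookup R y
      ... | true = ℚ.≤-trans (ℚ.≤-reflexive (ℚ.+-identityʳ _))
        (φ-budget γ 0≤γ (ι pos π y) (ι pos σ y) (b y) 0≤δ)
      ... | false = ℚ.≤-refl
      by-cases : Dec (y ≡ x) → after y ℚ.+ 0ℚ ℚ.≤ before y ℚ.+ gain y
      by-cases (yes refl) = ℚ.+-mono-≤ (ℚ.≤-trans after-x (0≤ψ ℓ (pos σ x) (0≤b x))) (0≤gain x)
      by-cases (no y≢x) = after-≢ y≢x budgeted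

    total : ∀ u {d} → after u ℚ.+ d ℚ.≤ before u ℚ.+ gain u →
      Φ π₁ σ b₁ ℚ.+ d ℚ.≤ Φ π σ b ℚ.+ (ι ℓ ℚ.+ (ι ℓ ℚ.+ ι ℓ))
    total u h = ℚ.≤-trans
      (sum-mono-≤-at u (λ y _ → ℚ.≤-trans (ℚ.≤-reflexive (sym (ℚ.+-identityʳ (after y)))) (after≤ y))
        h)
      (ℚ.≤-trans (ℚ.≤-reflexive (trans (∑-distrib-+ before gain)
          (cong (Φ π σ b ℚ.+_) (∑-distrib-+ (λ y → charge c ℓ (pos σ y)) _))))
        (ℚ.+-monoʳ-≤ (Φ π σ b) (ℚ.+-mono-≤ (sum-charge c ℓ σ) (ℚ.≤-reflexive raised))))
      where
      raised : sum (λ y → if lookup R y then δ ℚ.+ δ else 0ℚ) ≡ ι ℓ ℚ.+ ι ℓ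
      raised = trans (sum-subset R (δ ℚ.+ δ))
        (trans (ℚ.*-distribˡ-+ (ι ∣ R ∣) δ δ) (cong₂ ℚ._+_ Rδ≡ℓ Rδ≡ℓ))

    drop : ∀ u → u ∈ R → 8 * g * pos σ u < ℓ →
      after u ℚ.+ ι (5 * ℓ) ℚ.≤ before u ℚ.+ gain u
    drop u u∈R far = by-cases (u ≟ x)
      where
      ℓ≤πu : ℓ ≤ pos π u
      ℓ≤πu = proj₂ x-min u u∈R
      b≤p : b u ℚ.≤ ι pos π u
      b≤p = subst (b u ℚ.≤_) (ι-posℚ π u) (ℚ.<⇒≤ (b<pos u))
      8γq≤p : ι 8 ℚ.* γ ℚ.* ι pos σ u ℚ.≤ ι pos π u
      8γq≤p = subst (ℚ._≤ ι pos π u)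
        (trans (ι-* (8 * g) (pos σ u)) (cong (ℚ._* ι pos σ u) (ι-* 8 g)))
        (ι-mono-≤ (ℕ.≤-trans (ℕ.<⇒≤ far) ℓ≤πu))
      5ℓ≤γp : ι (5 * ℓ) ℚ.≤ γ ℚ.* ι pos π u
      5ℓ≤γp = ℚ.≤-trans (ι-mono-≤
          (ℕ.*-mono-≤ (subst (5 ≤_) (sym g≡5r) (ℕ.*-monoʳ-≤ 5 1≤r)) ℓ≤πu))
        (ℚ.≤-reflexive (ι-* g (pos π u)))
      -- This fixes γ = 5r: γδ = 5rδ ≥ 5|R|δ = 5ℓ.
      5ℓ≤γδ : ι (5 * ℓ) ℚ.≤ γ ℚ.* δ
      5ℓ≤γδ = subst₂ ℚ._≤_
        (sym (trans (ι-* 5 ℓ) (cong (ι 5 ℚ.*_) (sym Rδ≡ℓ))))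
        (trans (sym (ℚ.*-assoc (ι 5) (ι r) δ))
          (cong (ℚ._* δ) (sym (trans (cong ι_ g≡5r) (ι-* 5 r)))))
        (slack⇒≤ (0≤* (0≤* (0≤ι 5) 0≤δ) (0≤- (ι-mono-≤ ∣R∣≤r)))
          (solve 4 (λ k s δ r → k :* (s :* δ) :+ k :* δ :* (r :- s) := k :* (r :* δ)) refl
            (ι 5) (ι ∣ R ∣) δ (ι r)))
      budgeted : ψ (pos π u) (pos σ u) (if lookup R u then b u ℚ.+ δ else b u) ℚ.+ ι (5 * ℓ)
        ℚ.≤ before u ℚ.+ (if lookup R u then δ ℚ.+ δ else 0ℚ)
      budgeted rewrite []=⇒lookup u∈R =
        φ-budget-large γ 0≤γ (ι pos π u) (ι pos σ u) (b u) (0≤ι (5 * ℓ)) b≤p 8γq≤p 5ℓ≤γp 5ℓ≤γδ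
      by-cases : Dec (u ≡ x) → after u ℚ.+ ι (5 * ℓ) ℚ.≤ before u ℚ.+ gain u
      -- Here `u` itself is fetched: its term was at least γℓ ≥ 5ℓ and becomes at most 0.
      by-cases (yes refl) = subst (after x ℚ.+ ι (5 * ℓ) ℚ.≤_) (ℚ.+-comm (gain x) (before x))
        (ℚ.+-mono-≤ (ℚ.≤-trans after-x (0≤gain x)) (ℚ.≤-trans 5ℓ≤γp (ℚ.≤-trans
          (excess-large γ 0≤γ (ι ℓ) (ι pos σ x) (b x) b≤p 8γq≤p)
          (excess≤φ γ 0≤γ (ι ℓ) (ι pos σ x) (0≤b x)))))
      by-cases (no u≢x) = after-≢ u≢x budgeted

    -- The 2ℓ on the left pays for the access and the fetch of `x`. Together with the rise of 3ℓ
    -- this makes 5ℓ, covered by the offline access cost if ℓ ≤ 8γq and by the drop of the term of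
    -- `u` otherwise.
    amortised : ∀ u → u ∈ R → Φ π₁ σ b₁ ℚ.+ (ι ℓ ℚ.+ ι ℓ) ℚ.≤ Φ π σ b ℚ.+ ι (K * pos σ u)
    amortised u u∈R with ℓ ℕ.≤? 8 * g * pos σ u
    ... | yes near = slack⇒≤
      (0≤+ (0≤- (total u (after≤ u))) (0≤- (subst (ℚ._≤ ι (K * pos σ u)) (ι-5* ℓ)
        (ι-mono-≤ (ℕ.≤-trans (ℕ.*-monoʳ-≤ 5 near) (5*[8*g*q]≤K*q (pos σ u)))))))
      (solve 4 (λ a l f k → a :+ (l :+ l) :+ ((f :+ (l :+ (l :+ l)) :- (a :+ con 0ℚ)) :+
          (k :- (l :+ (l :+ (l :+ (l :+ l)))))) := f :+ k) refl
        (Φ π₁ σ b₁) (ι ℓ) (Φ π σ b) (ι (K * pos σ u)))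
    ... | no ¬near = slack⇒≤
      (0≤+ (0≤- (subst (λ e → Φ π₁ σ b₁ ℚ.+ e ℚ.≤ Φ π σ b ℚ.+ (ι ℓ ℚ.+ (ι ℓ ℚ.+ ι ℓ))) (ι-5* ℓ)
          (total u (drop u u∈R (ℕ.≰⇒> ¬near))))) (0≤ι (K * pos σ u)))
      (solve 4 (λ a l f k → a :+ (l :+ l) :+ ((f :+ (l :+ (l :+ l)) :-
          (a :+ (l :+ (l :+ (l :+ (l :+ l)))))) :+ k) := f :+ k) refl
        (Φ π₁ σ b₁) (ι ℓ) (Φ π σ b) (ι (K * pos σ u)))

  -- Offline reordering.

  Φ-AdjSwap : ∀ {n} (π σ τ : Permutation′ n) b → AdjSwap σ τ → Φ π τ b ℚ.≤ Φ π σ b ℚ.+ ι K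
  Φ-AdjSwap π σ τ b s with AdjSwap-cases σ τ s
  ... | w , σw≡1+τw , σ≤τ = slack⇒≤
    (0≤- (sum-mono-≤-at {f = λ y → ψ (pos π y) (pos τ y) (b y)} w
      (λ y y≢w → φ-antitone γ 0≤γ (ι pos π y) (b y) (ι-mono-≤ (σ≤τ y y≢w))) at-w))
    (solve 3 (λ x k y → x :+ (y :- (x :+ (:- k))) := y :+ k) refl (Φ π τ b) (ι K) (Φ π σ b))
    where
    -- Taking -K as the change at `w` turns the bound on sums into a bound on the increase.
    at-w : ψ (pos π w) (pos τ w) (b w) ℚ.+ ℚ.- ι K ℚ.≤ ψ (pos π w) (pos σ w) (b w)
    at-w rewrite σw≡1+τw | ι-+ 1 (pos τ w) | sym 4γ*4γ≡ιK = slack⇒≤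
      (0≤- (φ-opt-back γ 0≤γ (ι pos π w) (ι pos τ w) (b w)))
      (solve 3 (λ x k y → x :+ (:- k) :+ (y :+ k :- x) := y) refl
        (ψ (pos π w) (pos τ w) (b w)) (ι 4 ℚ.* γ ℚ.* (ι 4 ℚ.* γ)) _)

  Φ-Swaps : ∀ {n} (π σ τ : Permutation′ n) b {k} → Swaps σ τ k → Φ π τ b ℚ.≤ Φ π σ b ℚ.+ ι (K * k)
  Φ-Swaps π σ τ b (none σ≈τ) = ℚ.≤-trans
    (sum-mono-≤ λ y → ℚ.≤-reflexive (cong (λ i → ψ (pos π y) (suc (toℕ i)) (b y)) (sym (σ≈τ y))))
    (slack⇒≤ (0≤ι (K * 0)) refl)
  Φ-Swaps π σ τ b {suc k} (more {τ = ρ} a s) = slack⇒≤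
    (0≤+ (0≤- (Φ-AdjSwap π σ ρ b a)) (0≤- (Φ-Swaps π ρ τ b s)))
    (trans (solve 5 (λ x y z k l → x :+ ((z :+ k :- y) :+ (y :+ l :- x)) := z :+ (k :+ l)) refl
        (Φ π τ b) (Φ π ρ b) (Φ π σ b) (ι K) (ι (K * k)))
      (cong (Φ π σ b ℚ.+_) (sym (trans (cong ι_ (ℕ.*-suc K k)) (ι-+ K (K * k))))))

  -- A full step and the whole run.

  Requests : ∀ {n} → List (Subset n) → Set
  Requests = All (λ R → Nonempty R × ∣ R ∣ ≤ r)

  -- Three moves in sequence: the request and then the cleanup, both against the old offline list,
  -- and last the offline reordering.
  step-amortised : ∀ {n} {R : Subset n} (π σ σ′ : Permutation′ n) {b π′ b′ ℓ k ℓ* k*} →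
    ∣ R ∣ ≤ r → (∀ y → 0ℚ ℚ.≤ b y) → (∀ y → b y ℚ.< posℚ π y) →
    DLMStep R π b π′ b′ ℓ → IsDist π π′ k → AccessCost σ R ℓ* → IsDist σ σ′ k* →
    ι (ℓ + k) ℚ.+ Φ π′ σ′ b′ ℚ.≤ Φ π σ b ℚ.+ ι (K * (ℓ* + k*)) ×
      (∀ y → 0ℚ ℚ.≤ b′ y) × (∀ y → b′ y ℚ.< posℚ π′ y)
  step-amortised {R = R} π σ σ′ {b} {π′} {b′} {ℓ} {k} {_} {k*} ∣R∣≤r 0≤b b<pos
    (step {π₁ = π₁} x s ∣R∣≡ x-min F C) (_ , k-least) (u , (u∈R , _) , refl) (swaps* , _) =
    let j , swaps , cleaned , inv = Cleanup-amortised π₁ σ C 0≤b₁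
        -- The reordering cost is a distance, hence at most the number of swaps in the fetches.
        k≤ = k-least _ (Swaps-trans (Fetch⇒Swaps (toℕ (π ⟨$⟩ʳ x)) {π} refl F) swaps)
        cost≤ : ℓ + k ≤ ℓ + (ℓ + j)
        cost≤ = ℕ.+-monoʳ-≤ ℓ (ℕ.≤-trans k≤ (ℕ.n≤1+n _))
    in slack⇒≤
      (0≤+ (0≤- (subst (ι (ℓ + k) ℚ.≤_) (trans (ι-+ ℓ (ℓ + j)) (cong (ι ℓ ℚ.+_) (ι-+ ℓ j)))
          (ι-mono-≤ cost≤)))
        (0≤+ (0≤- (requested u u∈R)) (0≤+ (0≤- cleaned) (0≤- (Φ-Swaps π′ σ σ′ b′ swaps*)))))
      (trans (solve 9 (λ a f′ l j f₁ f f″ m n →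
            a :+ f′ :+ ((l :+ (l :+ j) :- a) :+ ((f :+ m :- (f₁ :+ (l :+ l))) :+
              ((f₁ :- (j :+ f″)) :+ (f″ :+ n :- f′)))) := f :+ (m :+ n)) refl
          (ι (ℓ + k)) (Φ π′ σ′ b′) (ι ℓ) (ι j) (Φ π₁ σ (DLM-budget R b x δ)) (Φ π σ b)
          (Φ π′ σ b′) (ι (K * pos σ u)) (ι (K * k*)))
        (cong (Φ π σ b ℚ.+_) (trans (sym (ι-+ (K * pos σ u) (K * k*)))
          (cong ι_ (sym (ℕ.*-distribˡ-+ K (pos σ u) k*)))))) ,
      inv
    where
    δ = (+ ℓ) / suc s
    0≤δ : 0ℚ ℚ.≤ δ
    0≤δ = ℚ.nonNegative⁻¹ δ {{ℚ.normalize-nonNeg ℓ (suc s)}}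
    Rδ≡ℓ : ι ∣ R ∣ ℚ.* δ ≡ ι ℓ
    Rδ≡ℓ = trans (cong (λ m → ι m ℚ.* δ) ∣R∣≡) (trans (ℚ.*-comm (ι suc s) δ) (/-*-cancel ℓ s))
    0≤b₁ : ∀ y → 0ℚ ℚ.≤ DLM-budget R b x δ y
    0≤b₁ y with does (y ≟ x) | lookup R y
    ... | true | _ = ℚ.≤-refl
    ... | false | true = 0≤+ (0≤b y) 0≤δ
    ... | false | false = 0≤b y
    requested = Request.amortised R π π₁ σ 0≤b b<pos x-min F 0≤δ Rδ≡ℓ ∣R∣≤r

  -- The step bounds telescope; the potential left at the end is nonnegative and is discarded.
  competitive : ∀ {n} (π σ : Permutation′ n) {b Rs cDLM cOff} → Requests Rs →
    (∀ y → 0ℚ ℚ.≤ b y) → (∀ y → b y ℚ.< posℚ π y) →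
    DLMRun π b Rs cDLM → OffRun σ Rs cOff → ι cDLM ℚ.≤ Φ π σ b ℚ.+ ι (K * cOff)
  competitive π σ [] 0≤b b<pos done done =
    ℚ.≤-trans (ℚ.≤-reflexive ι-0) (0≤+ (0≤Φ π σ 0≤b) (0≤ι (K * 0)))
  competitive π σ {b} ((_ , ∣R∣≤r) ∷ Rs≤r) 0≤b b<pos
    (next {π' = π′} {b' = b′} {ℓ = ℓ} {k} {c₁} S d run)
    (next {π' = σ′} {ℓ = ℓ*} {k*} {c*} a d* run*)
    with step-amortised π σ σ′ ∣R∣≤r 0≤b b<pos S d a d*
  ... | bound , 0≤b′ , b′<pos = slack⇒≤
    (0≤+ (0≤- bound) (0≤- (competitive π′ σ′ Rs≤r 0≤b′ b′<pos run run*)))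
    (trans (cong₂ ℚ._+_ (ι-+ (ℓ + k) c₁) refl)
      (trans (solve 6 (λ p q f′ f m n →
          p :+ q :+ ((f :+ m :- (p :+ f′)) :+ (f′ :+ n :- q)) := f :+ (m :+ n)) refl
          (ι (ℓ + k)) (ι c₁) (Φ π′ σ′ b′) (Φ π σ b) (ι (K * (ℓ* + k*))) (ι (K * c*)))
        (cong (Φ π σ b ℚ.+_) (trans (sym (ι-+ (K * (ℓ* + k*)) (K * c*)))
          (cong ι_ (sym (ℕ.*-distribˡ-+ K (ℓ* + k*) c*)))))))

theorem13 : Σ ℕ λ C → 0 < C ×
    ((n r : ℕ) → 1 ≤ n → 1 ≤ r →
    (π₀ : Permutation′ n) (Rs : List (Subset n)) →
    All (λ R → Nonempty R × ∣ R ∣ ≤ r) Rs →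
    (cDLM : ℕ) → DLMRun π₀ (λ _ → 0ℚ) Rs cDLM →
    (cOff : ℕ) → OffRun π₀ Rs cOff →
    cDLM ≤ C * r ^ 2 * cOff)
theorem13 = 400 , s≤s z≤n , λ n r _ 1≤r π₀ Rs Rs≤r cDLM run cOff run* →
  let open Amortisation r 1≤r in
  subst (λ K → cDLM ≤ K * cOff) K≡400r² (ι-cancel-≤ (ℚ.≤-trans
    -- Positions start at 1, so zero budgets satisfy the invariant b < p.
    (competitive π₀ π₀ Rs≤r (λ _ → ℚ.≤-refl) (λ y → 0<posℚ π₀ y) run run*)
    (ℚ.≤-trans (ℚ.+-monoˡ-≤ (ι (K * cOff)) (Φ-initial π₀))
      (ℚ.≤-reflexive (ℚ.+-identityˡ (ι (K * cOff)))))))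
  where
  0<posℚ : ∀ {n} (π : Permutation′ n) y → 0ℚ ℚ.< posℚ π y
  0<posℚ π y = ℚ.positive⁻¹ (posℚ π y) {{ℚ.normalize-pos (pos π y) 1}}
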